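{- Let $C(z)=\sum_{n\ge 0}c_n z^n$, where $c_n$ is the number of nonnesting permutations of the multiset $\{1,1,2,2,\dots,n,n\}$ that avoid the pattern $123$ (with $c_0=1$). Let $V,U\in\mathbb{Q}[[z]]$ be the formal power series with constant term $1$ satisfying $V=1+zV^2$ and $U=1+3z+zU^2$. Then \[ C(z)=1+\frac{z(1+U)}{2-z(1+U)(1+V)} . \]
   Context: For $n\ge 0$, a nonnesting permutation of $\{1,1,2,2,\dots,n,n\}$ is a word $w=w_1w_2\cdots w_{2n}$ using each of the labels $1,\dots,n$ exactly twice such that there are no indices $i<j<k<\ell$ and labels $a\ne b$ with $w_i=w_\ell=a$ and $w_j=w_k=b$. The word $w$ avoids $123$ if there are no indices $i<j<k$ with $w_i<w_j<w_k$. The empty word is the unique such word for $n=0$. -}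

module Defs where

open import Algebra.Properties.Monoid.Sum using (sum⁺-syntax)
open import Data.Fin.Base as Fin using (Fin; toℕ)
import Data.Fin.Properties as Fin
open import Data.Integer.Base using (+_)
open import Data.List.Base
  using (List; []; _∷_; length; filter; allFin; cartesianProductWith)
open import Data.List.Membership.Propositional using (_∈_)
open import Data.List.Membership.Propositional.Properties
  using (∈-allFin; ∈-cartesianProductWith⁺)
open import Data.List.Relation.Unary.Any using (here)
open import Data.List.Relation.Unary.All using ([])
open import Data.List.Relation.Unary.AllPairs using ([]; _∷_)
open import Data.List.Relation.Unary.Unique.Propositional using (Unique)
open import Data.List.Relation.Unary.Unique.Propositional.Properties
  using (allFin⁺; cartesianProductWith⁺)
open import Data.Nat.Base as ℕ using (ℕ; zero; suc; _∸_)
import Data.Nat.Properties as ℕ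
open import Data.Product.Base using (_×_; ∃-syntax)
open import Data.Rational.Base as ℚ using (ℚ; 0ℚ; NonZero)
import Data.Rational.Properties as ℚ
open import Data.Vec.Base using (Vec; []; _∷_; lookup; count)
open import Data.Vec.Properties using (∷-injective)
open import Relation.Binary.PropositionalEquality
open import Relation.Nullary.Decidable using (Dec; ¬?; _×-dec_)
open import Relation.Nullary.Negation using (¬_)
open import Relation.Unary using (Decidable)

------------------------------------------------------------------------
-- Nonnesting permutations

-- The labels 1 < 2 < ⋯ < n are represented by the elements of Fin n.
Word : ℕ → Set
Word n = Vec (Fin n) (2 ℕ.* n)

UsesEachLabelTwice : ∀ {n} → Word n → Set
UsesEachLabelTwice w = ∀ a → count (a Fin.≟_) w ≡ 2

HasNesting : ∀ {n} → Word n → Set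
HasNesting w =
  ∃[ i ] ∃[ j ] ∃[ k ] ∃[ ℓ ] ∃[ a ] ∃[ b ]
    i Fin.< j × j Fin.< k × k Fin.< ℓ × a ≢ b ×
    lookup w i ≡ a × lookup w ℓ ≡ a × lookup w j ≡ b × lookup w k ≡ b

Nonnesting : ∀ {n} → Word n → Set
Nonnesting w = UsesEachLabelTwice w × ¬ HasNesting w

Contains123 : ∀ {n} → Word n → Set
Contains123 w =
  ∃[ i ] ∃[ j ] ∃[ k ]
    i Fin.< j × j Fin.< k ×
    lookup w i Fin.< lookup w j × lookup w j Fin.< lookup w k

Avoids123 : ∀ {n} → Word n → Set
Avoids123 w = ¬ Contains123 w

hasNesting? : ∀ {n} → Decidable (HasNesting {n})
hasNesting? w =
  Fin.any? λ i → Fin.any? λ j → Fin.any? λ k → Fin.any? λ ℓ →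
  Fin.any? λ a → Fin.any? λ b →
    i Fin.<? j ×-dec j Fin.<? k ×-dec k Fin.<? ℓ ×-dec ¬? (a Fin.≟ b) ×-dec
    lookup w i Fin.≟ a ×-dec lookup w ℓ Fin.≟ a ×-dec
    lookup w j Fin.≟ b ×-dec lookup w k Fin.≟ b

nonnesting? : ∀ {n} → Decidable (Nonnesting {n})
nonnesting? w =
  Fin.all? (λ a → count (a Fin.≟_) w ℕ.≟ 2) ×-dec ¬? (hasNesting? w)

avoids123? : ∀ {n} → Decidable (Avoids123 {n})
avoids123? w = ¬? (
  Fin.any? λ i → Fin.any? λ j → Fin.any? λ k →
    i Fin.<? j ×-dec j Fin.<? k ×-dec
    lookup w i Fin.<? lookup w j ×-dec lookup w j Fin.<? lookup w k)

allVecs : ∀ k m → List (Vec (Fin k) m)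
allVecs k zero    = [] ∷ []
allVecs k (suc m) = cartesianProductWith _∷_ (allFin k) (allVecs k m)

-- allVecs lists every vector exactly once, so filtering it counts vectors.
∈-allVecs : ∀ {k m} (v : Vec (Fin k) m) → v ∈ allVecs k m
∈-allVecs []      = here refl
∈-allVecs (x ∷ v) = ∈-cartesianProductWith⁺ _∷_ (∈-allFin x) (∈-allVecs v)

allVecs-unique : ∀ k m → Unique (allVecs k m)
allVecs-unique k zero    = [] ∷ []
allVecs-unique k (suc m) =
  cartesianProductWith⁺ _∷_ ∷-injective (allFin⁺ k) (allVecs-unique k m)

c : ℕ → ℕ
c n = length (filter (λ w → nonnesting? w ×-dec avoids123? w)
                     (allVecs n (2 ℕ.* n)))

------------------------------------------------------------------------
-- Formal power series over ℚ

-- f n is the coefficient of zⁿ; equality of series is _≗_.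
ℚ[[z]] : Set
ℚ[[z]] = ℕ → ℚ

infixl 6 _+_ _-_
infixl 7 _*_ _/_
infixr 8 z·_

constant : ℚ → ℚ[[z]]
constant q zero    = q
constant q (suc n) = 0ℚ

_+_ _-_ _*_ : ℚ[[z]] → ℚ[[z]] → ℚ[[z]]
(f + g) n = f n ℚ.+ g n
(f - g) n = f n ℚ.- g n
(f * g) n = sum⁺-syntax ℚ.+-0-monoid n (λ i → f (toℕ i) ℚ.* g (n ∸ toℕ i))

z·_ : ℚ[[z]] → ℚ[[z]]
(z· f) zero    = 0ℚ
(z· f) (suc n) = f n

-- Long division: writing f = f₀ + z f′, g = g₀ + z g′ and q₀ = f₀ / g₀, one has
-- f / g = q₀ + z ((f′ - q₀ g′) / g).
_/_ : (f g : ℚ[[z]]) .{{_ : NonZero (g 0)}} → ℚ[[z]]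
(f / g) zero    = f 0 ℚ.÷ g 0
(f / g) (suc n) = ((λ k → f (suc k) ℚ.- (f 0 ℚ.÷ g 0) ℚ.* g (suc k)) / g) n

/-*-cancel : ∀ f g .{{_ : NonZero (g 0)}} → (f / g) * g ≗ f
/-*-cancel f g zero = begin
  (f 0 ℚ.* ℚ.1/ g 0) ℚ.* g 0 ℚ.+ 0ℚ ≡⟨ ℚ.+-identityʳ _ ⟩
  (f 0 ℚ.* ℚ.1/ g 0) ℚ.* g 0        ≡⟨ ℚ.*-assoc (f 0) (ℚ.1/ g 0) (g 0) ⟩
  f 0 ℚ.* (ℚ.1/ g 0 ℚ.* g 0)        ≡⟨ cong (f 0 ℚ.*_) (ℚ.*-inverseˡ (g 0)) ⟩
  f 0 ℚ.* ℚ.1ℚ                      ≡⟨ ℚ.*-identityʳ (f 0) ⟩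
  f 0                               ∎
  where open ≡-Reasoning
/-*-cancel f g (suc n) = begin
  p ℚ.+ (r / g * g) n                ≡⟨ cong (p ℚ.+_) (/-*-cancel r g n) ⟩
  p ℚ.+ (f (suc n) ℚ.- p)            ≡⟨ ℚ.+-comm p _ ⟩
  (f (suc n) ℚ.- p) ℚ.+ p            ≡⟨ ℚ.+-assoc (f (suc n)) (ℚ.- p) p ⟩
  f (suc n) ℚ.+ (ℚ.- p ℚ.+ p)        ≡⟨ cong (f (suc n) ℚ.+_) (ℚ.+-inverseˡ p) ⟩
  f (suc n) ℚ.+ 0ℚ                   ≡⟨ ℚ.+-identityʳ _ ⟩
  f (suc n)                          ∎
  where
  open ≡-Reasoning
  p = (f 0 ℚ.÷ g 0) ℚ.* g (suc n)
  r : ℚ[[z]]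
  r k = f (suc k) ℚ.- (f 0 ℚ.÷ g 0) ℚ.* g (suc k)

𝟙 𝟚 𝟛 : ℚ[[z]]
𝟙 = constant (+ 1 ℚ./ 1)
𝟚 = constant (+ 2 ℚ./ 1)
𝟛 = constant (+ 3 ℚ./ 1)

C : ℚ[[z]]
C n = + c n ℚ./ 1

{-# OPTIONS --safe #-}
module Submission where

open import Defs
open import Data.Rational.Base using (1ℚ)
open import Relation.Binary.PropositionalEquality using (_≡_; _≗_)

open import Algebra.Bundles using (CommutativeRing)
open import Algebra.Properties.Group using (∙-cancelʳ)
import Algebra.Solver.Ring
open import Algebra.Solver.Ring.AlmostCommutativeRing
  using (AlmostCommutativeRing; fromCommutativeRing; _-Raw-AlmostCommutative⟶_)
open import Data.Bool.Base using (true; false; if_then_else_)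
open import Data.Fin.Base as Fin using (Fin; zero; suc; toℕ; opposite)
import Data.Fin.Properties as Fin
open import Data.Integer.Base as ℤ using (+_)
import Data.Integer.Properties as ℤ
open import Data.List.Base
  using (List; []; _∷_; [_]; _++_; length; map; drop; filter; tabulate)
open import Data.List.Membership.Propositional using (_∈_)
open import Data.List.Membership.Propositional.Properties
  using (∈-++⁺ˡ; ∈-++⁺ʳ; ∈-++⁻; ∈-insert; ∈-∃++; ∈-map⁺; ∈-map⁻; ∈-filter⁺; ∈-filter⁻; ∈-tabulate⁺)
open import Data.List.Membership.Propositional.Properties.WithK using (unique∧set⇒bag)
open import Data.List.Properties
  using (++-assoc; ++-identityʳ; length-++; length-map; length-tabulate; ∷-injectiveˡ; ∷-injectiveʳ)
open import Data.List.Relation.Binary.BagAndSetEquality using (∼bag⇒↭)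
open import Data.List.Relation.Binary.Permutation.Propositional.Properties using (↭-length)
open import Data.List.Relation.Binary.Sublist.Propositional
  using (_⊆_; []; _∷_; _∷ʳ_; ⊆-refl; ⊆-trans; minimum; from∈; to∈)
open import Data.List.Relation.Binary.Sublist.Propositional.Properties
  using (All-resp-⊆; Any-resp-⊆; ++⁺; ++⁺ˡ; ++⁺ʳ; ∷⁻)
open import Data.List.Relation.Unary.All as All using (All; []; _∷_)
import Data.List.Relation.Unary.All.Properties as All
open import Data.List.Relation.Unary.AllPairs using (AllPairs; []; _∷_)
open import Data.List.Relation.Unary.AllPairs.Properties using (tabulate⁺-<)
open import Data.List.Relation.Unary.Any using (here; there)
open import Data.List.Relation.Unary.Unique.Propositional using (Unique)
import Data.List.Relation.Unary.Unique.Propositional.Properties as Unique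
open import Data.Maybe.Base using () renaming (map to mapMaybe)
open import Data.Nat.Base as ℕ using (ℕ; zero; suc; z≤n; s≤s)
import Data.Nat.Properties as ℕ
import Data.Nat.Solver as ℕ
open import Data.Product.Base using (_×_; _,_; ∃-syntax; proj₁; proj₂)
open import Data.Rational.Base as ℚ using (ℚ; 0ℚ; ½)
import Data.Rational.Properties as ℚ
import Data.Rational.Solver as ℚ
import Data.Rational.Unnormalised.Base as ℚᵘ
import Data.Rational.Unnormalised.Properties as ℚᵘ
open import Data.Sum.Base using (_⊎_; inj₁; inj₂; [_,_]′; map₂)
open import Data.Vec.Base as Vec using (Vec; []; _∷_; lookup; toList)
open import Data.Vec.Properties using (toList∘fromList; toList-injective; cast-is-id)
open import Function.Base using (_∘_; id)
open import Function.Bundles using (mk⇔)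
open import Level using (0ℓ)
open import Relation.Binary.PropositionalEquality
  using (_≢_; refl; sym; trans; cong; cong₂; subst; subst₂; module ≡-Reasoning)
open import Relation.Binary.Structures using (IsEquivalence)
open import Relation.Nullary.Decidable using (Dec; does; yes; no; _×-dec_; dec⇒maybe)
open import Relation.Nullary.Negation using (¬_; contradiction)
open import Relation.Unary using (Pred; Decidable; ∅; _∪_)

-- Read a word from left to right, keeping the labels seen once in a queue: nonnesting means that
-- every letter is either a new label, which joins the queue, or the head of the queue.  Avoiding
-- 123 means that every letter is either at most the current minimum or a maximum of the letters
-- still to come.  A label in the queue that is not the current minimum must therefore exceed
-- everything after it when it leaves, which forces the queue to be decreasing up to the minimum,
-- with at most one label behind it.  The completions of a prefix then depend only on p, the
-- number of labels below the minimum, s, the number of unused labels above it, and r, the number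
-- of queued labels above all unused ones.
--
-- For each s and r the generating functions in zᵖ satisfy a linear system whose dependence on s
-- and r has constant coefficients.  Its characteristic equations are those of U (in s) and of V
-- (in r), so the solution is explicit: with μ = 2 / (2 - z (1 + U) (1 + V)), the completions that
-- begin with a new minimum are counted by μ Uˢ⁻¹ (U - 1) / 2 for s > 0 and z μ Vʳ (1 + U) / 2 for
-- s = 0.

-- The ring of formal power series

module SeriesRing where

  infix 8 -_

  0ₛ 1ₛ : ℚ[[z]]
  0ₛ = constant 0ℚ
  1ₛ = constant 1ℚ

  -_ : ℚ[[z]] → ℚ[[z]]
  (- f) n = ℚ.- f n

  -- The sum defining the product unfolds: coefficient `suc n` of `f * g` is `f 0 ℚ.* g (suc n)`
  -- plus coefficient `n` of `tail f * g`. The product laws follow by induction along this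
  -- recursion.
  tail : ℚ[[z]] → ℚ[[z]]
  tail f n = f (suc n)

  open ≡-Reasoning
  open ℚ.+-*-Solver using (solve; con; _:=_; _:+_; _:*_)

  *-congˡ : ∀ f {g h} → g ≗ h → f * g ≗ f * h
  *-congˡ f g≗h zero    = cong (λ x → f 0 ℚ.* x ℚ.+ 0ℚ) (g≗h 0)
  *-congˡ f g≗h (suc n) =
    cong₂ ℚ._+_ (cong (f 0 ℚ.*_) (g≗h (suc n))) (*-congˡ (tail f) g≗h n)

  *-congʳ : ∀ h {f g} → f ≗ g → f * h ≗ g * h
  *-congʳ h f≗g zero    = cong (λ x → x ℚ.* h 0 ℚ.+ 0ℚ) (f≗g 0)
  *-congʳ h f≗g (suc n) =
    cong₂ ℚ._+_ (cong (ℚ._* h (suc n)) (f≗g 0)) (*-congʳ h (f≗g ∘ suc) n)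

  *-cong : ∀ {f g h k} → f ≗ g → h ≗ k → f * h ≗ g * k
  *-cong {g = g} {h} f≗g h≗k n = trans (*-congʳ h f≗g n) (*-congˡ g h≗k n)

  *-distribʳ-+ : ∀ h f g → (f + g) * h ≗ f * h + g * h
  *-distribʳ-+ h f g zero    =
    solve 3 (λ a b c → (a :+ b) :* c :+ con 0ℚ := (a :* c :+ con 0ℚ) :+ (b :* c :+ con 0ℚ)) refl
      (f 0) (g 0) (h 0)
  *-distribʳ-+ h f g (suc n) = begin
    (f 0 ℚ.+ g 0) ℚ.* h (suc n) ℚ.+ ((tail f + tail g) * h) n
      ≡⟨ cong ((f 0 ℚ.+ g 0) ℚ.* h (suc n) ℚ.+_) (*-distribʳ-+ h (tail f) (tail g) n) ⟩
    (f 0 ℚ.+ g 0) ℚ.* h (suc n) ℚ.+ ((tail f * h) n ℚ.+ (tail g * h) n)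
      ≡⟨ solve 5 (λ a b c d e → (a :+ b) :* c :+ (d :+ e) := (a :* c :+ d) :+ (b :* c :+ e)) refl
           (f 0) (g 0) (h (suc n)) ((tail f * h) n) ((tail g * h) n) ⟩
    (f * h + g * h) (suc n) ∎

  *-scaleˡ : ∀ q f g n → ((λ k → q ℚ.* f k) * g) n ≡ q ℚ.* (f * g) n
  *-scaleˡ q f g zero    =
    solve 3 (λ a b c → a :* b :* c :+ con 0ℚ := a :* (b :* c :+ con 0ℚ)) refl q (f 0) (g 0)
  *-scaleˡ q f g (suc n) = begin
    q ℚ.* f 0 ℚ.* g (suc n) ℚ.+ ((λ k → q ℚ.* f (suc k)) * g) n
      ≡⟨ cong (q ℚ.* f 0 ℚ.* g (suc n) ℚ.+_) (*-scaleˡ q (tail f) g n) ⟩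
    q ℚ.* f 0 ℚ.* g (suc n) ℚ.+ q ℚ.* (tail f * g) n
      ≡⟨ solve 4 (λ a b c d → a :* b :* c :+ a :* d := a :* (b :* c :+ d)) refl
           q (f 0) (g (suc n)) ((tail f * g) n) ⟩
    q ℚ.* (f * g) (suc n) ∎

  *-assoc : ∀ f g h → (f * g) * h ≗ f * (g * h)
  *-assoc f g h zero    =
    solve 3 (λ a b c → (a :* b :+ con 0ℚ) :* c :+ con 0ℚ := a :* (b :* c :+ con 0ℚ) :+ con 0ℚ) refl
      (f 0) (g 0) (h 0)
  *-assoc f g h (suc n) = begin
    (f 0 ℚ.* g 0 ℚ.+ 0ℚ) ℚ.* h (suc n) ℚ.+ (((λ k → f 0 ℚ.* g (suc k)) + tail f * g) * h) n
      ≡⟨ cong₂ ℚ._+_ (cong (ℚ._* h (suc n)) (ℚ.+-identityʳ (f 0 ℚ.* g 0)))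
           (trans (*-distribʳ-+ h (λ k → f 0 ℚ.* g (suc k)) (tail f * g) n)
             (cong₂ ℚ._+_ (*-scaleˡ (f 0) (tail g) h n) (*-assoc (tail f) g h n))) ⟩
    f 0 ℚ.* g 0 ℚ.* h (suc n) ℚ.+ (f 0 ℚ.* (tail g * h) n ℚ.+ (tail f * (g * h)) n)
      ≡⟨ solve 5 (λ a b c d e → a :* b :* c :+ (a :* d :+ e) := a :* (b :* c :+ d) :+ e) refl
           (f 0) (g 0) (h (suc n)) ((tail g * h) n) ((tail f * (g * h)) n) ⟩
    (f * (g * h)) (suc n) ∎

  -- Splits off the last term of the convolution instead of the first; comparing the two splittings
  -- gives commutativity.
  *-tailʳ : ∀ f g n → (f * g) (suc n) ≡ f (suc n) ℚ.* g 0 ℚ.+ (f * tail g) n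
  *-tailʳ f g zero    =
    solve 4 (λ a b c d → a :* d :+ (b :* c :+ con 0ℚ) := b :* c :+ (a :* d :+ con 0ℚ)) refl
      (f 0) (f 1) (g 0) (g 1)
  *-tailʳ f g (suc n) = begin
    f 0 ℚ.* g (suc (suc n)) ℚ.+ (tail f * g) (suc n)
      ≡⟨ cong (f 0 ℚ.* g (suc (suc n)) ℚ.+_) (*-tailʳ (tail f) g n) ⟩
    f 0 ℚ.* g (suc (suc n)) ℚ.+ (f (suc (suc n)) ℚ.* g 0 ℚ.+ (tail f * tail g) n)
      ≡⟨ solve 3 (λ a b c → a :+ (b :+ c) := b :+ (a :+ c)) refl
           (f 0 ℚ.* g (suc (suc n))) (f (suc (suc n)) ℚ.* g 0) ((tail f * tail g) n) ⟩
    f (suc (suc n)) ℚ.* g 0 ℚ.+ (f * tail g) (suc n) ∎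

  *-comm : ∀ f g → f * g ≗ g * f
  *-comm f g zero    = cong (ℚ._+ 0ℚ) (ℚ.*-comm (f 0) (g 0))
  *-comm f g (suc n) = begin
    f 0 ℚ.* g (suc n) ℚ.+ (tail f * g) n
      ≡⟨ cong₂ ℚ._+_ (ℚ.*-comm (f 0) (g (suc n))) (*-comm (tail f) g n) ⟩
    g (suc n) ℚ.* f 0 ℚ.+ (g * tail f) n
      ≡⟨ *-tailʳ g f n ⟨
    (g * f) (suc n) ∎

  *-constant : ∀ q f n → (constant q * f) n ≡ q ℚ.* f n
  *-constant q f zero    = ℚ.+-identityʳ (q ℚ.* f 0)
  *-constant q f (suc n) = begin
    q ℚ.* f (suc n) ℚ.+ ((λ _ → 0ℚ) * f) n
      ≡⟨ cong (q ℚ.* f (suc n) ℚ.+_)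
           (trans (*-scaleˡ 0ℚ (λ _ → 0ℚ) f n) (ℚ.*-zeroˡ (((λ _ → 0ℚ) * f) n))) ⟩
    q ℚ.* f (suc n) ℚ.+ 0ℚ
      ≡⟨ ℚ.+-identityʳ (q ℚ.* f (suc n)) ⟩
    q ℚ.* f (suc n) ∎

  *-identityˡ : ∀ f → 1ₛ * f ≗ f
  *-identityˡ f n = trans (*-constant 1ℚ f n) (ℚ.*-identityˡ (f n))

  +-identityˡ : ∀ f → 0ₛ + f ≗ f
  +-identityˡ f zero    = ℚ.+-identityˡ (f 0)
  +-identityˡ f (suc n) = ℚ.+-identityˡ (f (suc n))

  -‿inverseˡ : ∀ f → (- f) + f ≗ 0ₛ
  -‿inverseˡ f zero    = ℚ.+-inverseˡ (f 0)
  -‿inverseˡ f (suc n) = ℚ.+-inverseˡ (f (suc n))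

  commutativeRing : CommutativeRing 0ℓ 0ℓ
  commutativeRing = record
    { Carrier = ℚ[[z]] ; _≈_ = _≗_ ; _+_ = _+_ ; _*_ = _*_ ; -_ = -_ ; 0# = 0ₛ ; 1# = 1ₛ
    ; isCommutativeRing = record
      { isRing = record
        { +-isAbelianGroup = record
          { isGroup = record
            { isMonoid = record
              { isSemigroup = record
                { isMagma = record
                  { isEquivalence = ≗-isEquivalence
                  ; ∙-cong = λ f≗g h≗k n → cong₂ ℚ._+_ (f≗g n) (h≗k n)
                  }
                ; assoc = λ f g h n → ℚ.+-assoc (f n) (g n) (h n)
                }
              ; identity = +-identityˡ , λ f n → trans (ℚ.+-comm (f n) (0ₛ n)) (+-identityˡ f n)
              }
            ; inverse = -‿inverseˡ , λ f n → trans (ℚ.+-comm (f n) (ℚ.- f n)) (-‿inverseˡ f n)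
            ; ⁻¹-cong = λ f≗g n → cong ℚ.-_ (f≗g n)
            }
          ; comm = λ f g n → ℚ.+-comm (f n) (g n)
          }
        ; *-cong = *-cong
        ; *-assoc = *-assoc
        ; *-identity = *-identityˡ , λ f n → trans (*-comm f 1ₛ n) (*-identityˡ f n)
        ; distrib = (λ f g h n → trans (*-comm f (g + h) n) (trans (*-distribʳ-+ f g h n)
                      (cong₂ ℚ._+_ (*-comm g f n) (*-comm h f n))))
                  , *-distribʳ-+
        }
      ; *-comm = *-comm
      }
    }
    where
    ≗-isEquivalence : IsEquivalence (_≗_ {A = ℕ} {B = ℚ})
    ≗-isEquivalence = record
      { refl = λ _ → refl ; sym = λ p n → sym (p n) ; trans = λ p q n → trans (p n) (q n) }

  almostCommutativeRing : AlmostCommutativeRing 0ℓ 0ℓ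
  almostCommutativeRing = fromCommutativeRing commutativeRing

  constant-morphism :
    CommutativeRing.rawRing ℚ.+-*-commutativeRing -Raw-AlmostCommutative⟶ almostCommutativeRing
  constant-morphism = record
    { ⟦_⟧    = constant
    ; +-homo = λ { p q zero → refl ; p q (suc n) → refl }
    ; *-homo = λ { p q zero    → sym (*-constant p (constant q) 0)
                 ; p q (suc n) → sym (trans (*-constant p (constant q) (suc n)) (ℚ.*-zeroʳ p)) }
    ; -‿homo = λ { p zero → refl ; p (suc n) → refl }
    ; 0-homo = λ _ → refl
    ; 1-homo = λ _ → refl
    }

  open import Algebra.Solver.Ring (CommutativeRing.rawRing ℚ.+-*-commutativeRing)
    almostCommutativeRing constant-morphism
    (λ p q → mapMaybe (λ p≡q n → cong (λ r → constant r n) p≡q) (dec⇒maybe (p ℚ.≟ q))) public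
    using ()
    renaming (solve to solveₛ; con to :con; _:=_ to _:≈_; _:+_ to _:⊕_; _:*_ to _:⊗_; _:-_ to _:⊖_)

  -- Makes the shift a multiplication, so that the ring solver can treat z as one more variable.
  z·≗Z* : ∀ f → z· f ≗ z· 1ₛ * f
  z·≗Z* f zero    = sym (trans (ℚ.+-identityʳ _) (ℚ.*-zeroˡ (f 0)))
  z·≗Z* f (suc n) = sym (begin
    0ℚ ℚ.* f (suc n) ℚ.+ (1ₛ * f) n ≡⟨ cong₂ ℚ._+_ (ℚ.*-zeroˡ (f (suc n))) (*-identityˡ f n) ⟩
    0ℚ ℚ.+ f n                      ≡⟨ ℚ.+-identityˡ (f n) ⟩
    f n                             ∎)

open SeriesRing

infixr 8 _^_
_^_ : ℚ[[z]] → ℕ → ℚ[[z]]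
f ^ zero  = 𝟙
f ^ suc n = f * f ^ n

Z : ℚ[[z]]
Z = z· 𝟙

open CommutativeRing commutativeRing
  using () renaming (+-cong to ⊕-cong; refl to ≗-refl; trans to ≗-trans; sym to ≗-sym)

-- Proves f ≗ g from f - g = q (l - r), stated without subtraction for the ring solver.
modulo : ∀ {f g} q {l r} → l ≗ r → f + q * r ≗ g + q * l → f ≗ g
modulo {f} {g} q {l} {r} l≗r eq n = ∙-cancelʳ ℚ.+-0-group ((q * r) n) (f n) (g n)
  (trans (eq n) (cong (g n ℚ.+_) (*-congˡ q l≗r n)))

-- The generating functions of the states

module States (V U : ℚ[[z]])
  (V-eq : V ≗ 𝟙 + z· (V * V)) (U-eq : U ≗ 𝟙 + z· 𝟛 + z· (U * U)) where

  denominator μ K E : ℚ[[z]]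
  denominator = 𝟚 - z· ((𝟙 + U) * (𝟙 + V))
  -- Division is allowed because coefficient 0 of `denominator` computes to 2, whatever `U` and `V`
  -- are.
  μ = 𝟚 / denominator
  K = constant ½ * (U - 𝟙)
  E = constant ½ * (𝟙 + U) * μ

  -- The coefficient of zᵖ in each series counts the runs of the family of the same name below,
  -- from a state with p labels in L, s in S and r in A.  The defining equations of free and held
  -- are the recurrences of the runs, while lower is the solution described
  -- in the header; lower-rec verifies its recurrence.
  lower free held : ℕ → ℕ → ℚ[[z]]
  lower zero    r = Z * (E * V ^ r)
  lower (suc s) r = μ * (K * U ^ s)

  free zero    zero    = 𝟙 + lower 0 0
  free (suc s) zero    = free s 1 + lower (suc s) 0
  free s       (suc r) = free s r + lower s (suc r)

  held zero    zero    = free 0 0 + lower 0 1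
  held (suc s) zero    = free (suc s) 0 + free s 1
  held zero    (suc r) = held 0 r + lower 0 (suc (suc r))
  held (suc s) (suc r) = held (suc s) r

  V-eqZ : V ≗ 𝟙 + Z * (V * V)
  V-eqZ n = trans (V-eq n) (cong (𝟙 n ℚ.+_) (z·≗Z* (V * V) n))

  U-eqZ : U ≗ 𝟙 + Z * 𝟛 + Z * (U * U)
  U-eqZ n = trans (U-eq n) (cong₂ ℚ._+_ (cong (𝟙 n ℚ.+_) (z·≗Z* 𝟛 n)) (z·≗Z* (U * U) n))

  denominatorZ : denominator ≗ 𝟚 - Z * ((𝟙 + U) * (𝟙 + V))
  denominatorZ n = cong (λ x → 𝟚 n ℚ.- x) (z·≗Z* ((𝟙 + U) * (𝟙 + V)) n)

  μ-eq : μ * (𝟚 - Z * ((𝟙 + U) * (𝟙 + V))) ≗ 𝟚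
  μ-eq = ≗-trans (*-congˡ μ (≗-sym denominatorZ)) (/-*-cancel 𝟚 denominator)

  -- For `s = 0` this is the equation of `μ`, since `lower 0 0 + lower 0 1` is half of z (1 + U) (1
  -- + V) μ. Each further label in S adds `lower (suc s)` twice, at `r = 0` and `r = 1`, and 2 K = U
  -- - 1 turns the sum into a factor `U`.
  free-1 : ∀ s → free s 1 ≗ μ * U ^ s
  free-1 zero = modulo (constant ½) (≗-sym μ-eq)
    (solveₛ 4 (λ u v m z → let h = :con ½ ; i = :con 1ℚ ; t = :con (+ 2 ℚ./ 1) ; e = h :⊗ (i :⊕ u) :⊗ m in
        ((i :⊕ z :⊗ (e :⊗ i)) :⊕ z :⊗ (e :⊗ (v :⊗ i)))
          :⊕ h :⊗ (m :⊗ (t :⊖ z :⊗ ((i :⊕ u) :⊗ (i :⊕ v))))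
        :≈ m :⊗ i :⊕ h :⊗ t)
      (λ _ → refl) U V μ Z)
  free-1 (suc s) = ≗-trans (⊕-cong (⊕-cong (free-1 s) ≗-refl) ≗-refl)
    (solveₛ 3 (λ u m p → let t = m :⊗ (:con ½ :⊗ (u :⊖ :con 1ℚ) :⊗ p) in
      ((m :⊗ p) :⊕ t) :⊕ t :≈ m :⊗ (u :⊗ p)) (λ _ → refl) U μ (U ^ s))

  -- By V = 1 + z V², the increment of `E * V ^ r` from `r` to `suc r` is exactly
  -- `lower 0 (suc (suc r))`.
  held-0 : ∀ r → held 0 r ≗ E * V ^ r - μ * K
  -- `held 0 0` and `free 0 1` unfold to the same sum.
  held-0 zero = ≗-trans (free-1 0)
    (solveₛ 2 (λ u m → let h = :con ½ ; i = :con 1ℚ in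
        m :⊗ i :≈ h :⊗ (i :⊕ u) :⊗ m :⊗ i :⊖ m :⊗ (h :⊗ (u :⊖ i)))
      (λ _ → refl) U μ)
  held-0 (suc r) = ≗-trans (⊕-cong (held-0 r) ≗-refl) (≗-sym (modulo (E * V ^ r) V-eqZ
    (solveₛ 5 (λ v e p d z → (e :⊗ (v :⊗ p) :⊖ d) :⊕ e :⊗ p :⊗ (:con 1ℚ :⊕ z :⊗ (v :⊗ v))
      :≈ ((e :⊗ p :⊖ d) :⊕ z :⊗ (e :⊗ (v :⊗ (v :⊗ p)))) :⊕ e :⊗ p :⊗ v)
      (λ _ → refl) V E (V ^ r) (μ * K) Z)))

  held-suc : ∀ s r → held (suc s) r ≗ μ * ((𝟚 + K) * U ^ s)
  held-suc s zero = ≗-trans (⊕-cong (⊕-cong (free-1 s) ≗-refl) (free-1 s))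
    (solveₛ 3 (λ m k p →
        ((m :⊗ p) :⊕ m :⊗ (k :⊗ p)) :⊕ m :⊗ p :≈ m :⊗ ((:con (+ 2 ℚ./ 1) :⊕ k) :⊗ p))
      (λ _ → refl) μ K (U ^ s))
  held-suc s (suc r) = held-suc s r

  -- For `s = 0` the term `μ * K` of `held 0 r` cancels against `lower 1 r`. For `suc s`, up to the
  -- factor `μ * U ^ s`, the claim is K = z (2 + K + K U), which is half of the equation of `U`.
  lower-Z : ∀ s r → lower s r ≗ Z * (held s r + lower (suc s) r)
  lower-Z zero r = ≗-trans
    (solveₛ 4 (λ e p d z → z :⊗ (e :⊗ p) :≈ z :⊗ ((e :⊗ p :⊖ d) :⊕ d)) (λ _ → refl)
      E (V ^ r) (μ * K) Z)
    (*-congˡ Z (⊕-cong (≗-sym (held-0 r)) (*-congˡ μ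
      (solveₛ 1 (λ k → k :≈ k :⊗ :con 1ℚ) (λ _ → refl) K))))
  lower-Z (suc s) r = ≗-trans
    (modulo (constant ½ * μ * U ^ s) U-eqZ
      (solveₛ 4 (λ u m p z → let h = :con ½ ; i = :con 1ℚ ; k = h :⊗ (u :⊖ i) in
        m :⊗ (k :⊗ p) :⊕ h :⊗ m :⊗ p :⊗ (i :⊕ z :⊗ :con (+ 3 ℚ./ 1) :⊕ z :⊗ (u :⊗ u))
        :≈ z :⊗ (m :⊗ ((:con (+ 2 ℚ./ 1) :⊕ k) :⊗ p) :⊕ m :⊗ (k :⊗ (u :⊗ p)))
          :⊕ h :⊗ m :⊗ p :⊗ u)
        (λ _ → refl) U μ (U ^ s) Z))
    (*-congˡ Z (⊕-cong (≗-sym (held-suc s r)) ≗-refl))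

  lower-rec : ∀ s r → lower s r ≗ z· (held s r + lower (suc s) r)
  lower-rec s r = ≗-trans (lower-Z s r) (≗-sym (z·≗Z* (held s r + lower (suc s) r)))

  free-00 : free 0 0 ≗ 𝟙 + (z· (𝟙 + U)) / denominator
  -- Cross-multiplication: `Z * E` and the quotient `q` both equal half of `μ * q` times the
  -- denominator.
  free-00 = ⊕-cong (≗-refl {𝟙}) (modulo (constant ½ * μ) (≗-sym q-eq)
    (modulo (constant ½ * q) μ-eq
      (solveₛ 5 (λ u m q d z → let h = :con ½ in
        (z :⊗ (h :⊗ (:con 1ℚ :⊕ u) :⊗ m :⊗ :con 1ℚ) :⊕ h :⊗ m :⊗ (q :⊗ d))
          :⊕ h :⊗ q :⊗ :con (+ 2 ℚ./ 1)
        :≈ (q :⊕ h :⊗ m :⊗ (z :⊗ (:con 1ℚ :⊕ u))) :⊕ h :⊗ q :⊗ (m :⊗ d))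
        (λ _ → refl) U μ q (𝟚 - Z * ((𝟙 + U) * (𝟙 + V))) Z)))
    where
    q : ℚ[[z]]
    q = (z· (𝟙 + U)) / denominator
    q-eq : q * (𝟚 - Z * ((𝟙 + U) * (𝟙 + V))) ≗ Z * (𝟙 + U)
    q-eq = ≗-trans (*-congˡ q (≗-sym denominatorZ))
      (≗-trans (/-*-cancel (z· (𝟙 + U)) denominator) (z·≗Z* (𝟙 + U)))

-- Counting sets of words

/1-homo-+ : ∀ m n → + (m ℕ.+ n) ℚ./ 1 ≡ + m ℚ./ 1 ℚ.+ + n ℚ./ 1
/1-homo-+ m n = ℚ.toℚᵘ-injective (begin
  ℚ.toℚᵘ (+ (m ℕ.+ n) ℚ./ 1)
    ≈⟨ ℚ.toℚᵘ-fromℚᵘ (+ (m ℕ.+ n) ℚᵘ./ 1) ⟩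
  + (m ℕ.+ n) ℚᵘ./ 1
    ≈⟨ ℚᵘ.*≡* (cong (ℤ._* (+ 1)) (trans (ℤ.pos-+ m n)
         (sym (cong₂ ℤ._+_ (ℤ.*-identityʳ (+ m)) (ℤ.*-identityʳ (+ n)))))) ⟩
  + m ℚᵘ./ 1 ℚᵘ.+ + n ℚᵘ./ 1
    ≈⟨ ℚᵘ.+-cong (ℚ.toℚᵘ-fromℚᵘ (+ m ℚᵘ./ 1)) (ℚ.toℚᵘ-fromℚᵘ (+ n ℚᵘ./ 1)) ⟨
  ℚ.toℚᵘ (+ m ℚ./ 1) ℚᵘ.+ ℚ.toℚᵘ (+ n ℚ./ 1)
    ≈⟨ ℚ.toℚᵘ-homo-+ (+ m ℚ./ 1) (+ n ℚ./ 1) ⟨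
  ℚ.toℚᵘ (+ m ℚ./ 1 ℚ.+ + n ℚ./ 1) ∎)
  where open ℚᵘ.≃-Reasoning

module _ {X : Set} where

  -- An explicit enumeration without repetition, to be compared as a bag with the list behind `c`.
  -- The size is taken in ℚ, where the coefficients of the series live.
  record Counted (P : Pred (List X) 0ℓ) (q : ℚ) : Set where
    field
      words    : List (List X)
      unique   : Unique words
      sound    : ∀ {v} → v ∈ words → P v
      complete : ∀ {v} → P v → v ∈ words
      size     : + length words ℚ./ 1 ≡ q

  data Cons (x : X) (P : Pred (List X) 0ℓ) : Pred (List X) 0ℓ where
    cons : ∀ {v} → P v → Cons x P (x ∷ v)

  module _ {P Q : Pred (List X) 0ℓ} where

    counted-∪ : ∀ {p q} → Counted P p → Counted Q q → (∀ {v} → P v → ¬ Q v) →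
      Counted (P ∪ Q) (p ℚ.+ q)
    counted-∪ ps qs disjoint = record
      { words    = ps.words ++ qs.words
      ; unique   = Unique.++⁺ ps.unique qs.unique
                     (λ (v∈ps , v∈qs) → disjoint (ps.sound v∈ps) (qs.sound v∈qs))
      ; sound    = [ inj₁ ∘ ps.sound , inj₂ ∘ qs.sound ]′ ∘ ∈-++⁻ ps.words
      ; complete = [ ∈-++⁺ˡ ∘ ps.complete , ∈-++⁺ʳ ps.words ∘ qs.complete ]′
      ; size     = trans (cong (λ k → + k ℚ./ 1) (length-++ ps.words))
                     (trans (/1-homo-+ (length ps.words) (length qs.words))
                       (cong₂ ℚ._+_ ps.size qs.size))
      }
      where
      module ps = Counted ps
      module qs = Counted qs

    counted-resp : ∀ {p q} → (∀ {v} → P v → Q v) → (∀ {v} → Q v → P v) → p ≡ q →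
      Counted P p → Counted Q q
    counted-resp P⇒Q Q⇒P refl ps = record
      { words = words ; unique = unique ; size = size
      ; sound = P⇒Q ∘ sound ; complete = complete ∘ Q⇒P }
      where open Counted ps

  counted-Cons : ∀ {P p} x → Counted P p → Counted (Cons x P) p
  counted-Cons {P} x ps = record
    { words    = map (x ∷_) words
    ; unique   = Unique.map⁺ ∷-injectiveʳ unique
    ; sound    = λ v∈ → sound′ (∈-map⁻ (x ∷_) v∈)
    ; complete = λ { (cons p) → ∈-map⁺ (x ∷_) (complete p) }
    ; size     = trans (cong (λ k → + k ℚ./ 1) (length-map (x ∷_) words)) size
    }
    where
    open Counted ps
    sound′ : ∀ {v} → ∃[ w ] w ∈ words × v ≡ x ∷ w → Cons x P v
    sound′ (_ , w∈ , refl) = cons (sound w∈)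

  counted-∅ : Counted ∅ 0ℚ
  counted-∅ = record { words = [] ; unique = [] ; sound = λ () ; complete = λ () ; size = refl }

  counted-[] : Counted (_≡ []) 1ℚ
  counted-[] = record
    { words = [] ∷ [] ; unique = [] ∷ [] ; size = refl
    ; sound = λ { (here refl) → refl ; (there ()) } ; complete = λ { refl → here refl } }

-- Runs

module _ {X : Set} where
  private variable
    a l s x : X
    A S L v : List X

  -- v completes a prefix with current minimum x, where L and S list the unused labels below and
  -- above x, and A the queued labels above all of S.  The queue is A in Free, where x has been
  -- used twice or the prefix is empty, and A ++ [ x ] in Held.  In Lower, with queue A, the next
  -- letter is a new minimum, found by walking down L: each skipped label becomes an unused label
  -- above it.
  data Free : (A S L v : List X) → Set
  data Held : (A : List X) (x : X) (S L v : List X) → Set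
  data Lower : (A S L v : List X) → Set

  data Free where
    end     : Free [] [] [] []
    popTop  : Free A S L v → Free (a ∷ A) S L (a ∷ v)
    pushTop : Free (s ∷ []) S L v → Free [] (s ∷ S) L (s ∷ v)
    pushLow : Lower A S L v → Free A S L v

  data Held where
    popTop     : Held A x S L v → Held (a ∷ A) x S L (a ∷ v)
    popMin     : Free [] S L v → Held [] x S L (x ∷ v)
    pushTopPop : Free (s ∷ []) S L v → Held [] x (s ∷ S) L (s ∷ x ∷ v)
    pushLow    : Lower (A ++ [ x ]) [] L v → Held A x [] L v

  data Lower where
    take : Held A l S L v → Lower A S (l ∷ L) (l ∷ v)
    skip : Lower A (S ++ [ l ]) L v → Lower A S (l ∷ L) v

  -- The first letter tells a new minimum from the other moves: it lies in L, while theirs lies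
  -- outside.
  Lower-head : Lower A S L v → ∃[ l ] ∃[ w ] l ∈ L × v ≡ l ∷ w
  Lower-head (take _) = _ , _ , here refl , refl
  Lower-head (skip t) with l , w , l∈L , eq ← Lower-head t = l , w , there l∈L , eq

  Cons-Lower-disjoint : ∀ {P} → ¬ a ∈ L → Cons a P v → ¬ Lower A S L v
  Cons-Lower-disjoint a∉L (cons p) t with _ , _ , a∈L , refl ← Lower-head t = a∉L a∈L

  Cons-disjoint : ∀ {P Q} → a ≢ x → Cons a P v → ¬ Cons x Q v
  Cons-disjoint a≢x (cons _) (cons _) = a≢x refl

  length-∷ʳ : ∀ (xs : List X) {y} → length (xs ++ [ y ]) ≡ suc (length xs)
  length-∷ʳ xs = trans (length-++ xs) (ℕ.+-comm (length xs) 1)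

  ++-∷ʳ-assoc : ∀ (ws xs : List X) y zs → ws ++ (xs ++ [ y ]) ++ zs ≡ ws ++ xs ++ y ∷ zs
  ++-∷ʳ-assoc ws xs y zs = cong (ws ++_) (++-assoc xs (y ∷ []) zs)

-- Decreasing lists of labels

Chain : ∀ {k} → List (Fin k) → Set
Chain = AllPairs Fin._>_

Chain-resp-⊆ : ∀ {k} {xs ys : List (Fin k)} → xs ⊆ ys → Chain ys → Chain xs
Chain-resp-⊆ []          []        = []
Chain-resp-⊆ (y ∷ʳ τ)    (_ ∷ ch)  = Chain-resp-⊆ τ ch
Chain-resp-⊆ (refl ∷ τ)  (y> ∷ ch) = All-resp-⊆ τ y> ∷ Chain-resp-⊆ τ ch

Chain-++⁻ʳ : ∀ {k} (xs : List (Fin k)) {ys} → Chain (xs ++ ys) → Chain ys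
Chain-++⁻ʳ []       ch       = ch
Chain-++⁻ʳ (x ∷ xs) (_ ∷ ch) = Chain-++⁻ʳ xs ch

head∉ : ∀ {k} {x : Fin k} {xs} → Chain (x ∷ xs) → ¬ x ∈ xs
head∉ (x> ∷ _) x∈xs = Fin.<-irrefl refl (All.lookup x> x∈xs)

before : ∀ {k} {x y : Fin k} {xs} → Chain xs → x ∷ y ∷ [] ⊆ xs → y Fin.< x
before ch τ with (y<x ∷ []) ∷ _ ← Chain-resp-⊆ τ ch = y<x

above : ∀ {k} {x : Fin k} xs {ys} → Chain (xs ++ x ∷ ys) → All (x Fin.<_) xs
above xs ch = All.tabulate λ y∈xs → before ch (++⁺ (from∈ y∈xs) (refl ∷ minimum _))

below : ∀ {k} {x : Fin k} {xs} → Chain (x ∷ xs) → All (Fin._≤ x) xs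
below (x> ∷ _) = All.map ℕ.<⇒≤ x>

Chain-delete : ∀ {k} {x : Fin k} xs {ys} → Chain (xs ++ x ∷ ys) → Chain (xs ++ ys)
Chain-delete xs = Chain-resp-⊆ (++⁺ (⊆-refl {x = xs}) (_ ∷ʳ ⊆-refl))

-- Counting the runs

module Counting {k : ℕ} (V U : ℚ[[z]])
  (V-eq : V ≗ 𝟙 + z· (V * V)) (U-eq : U ≗ 𝟙 + z· 𝟛 + z· (U * U)) where

  open States V U V-eq U-eq

  -- The clauses follow those of `free` and `held` and the recurrence `lower-rec`. Numbers add up
  -- because the alternatives differ in their first letter, all labels in the chain being distinct,
  -- or one of them is the empty word.
  count-Free : ∀ A S L → Chain {k} (A ++ S ++ L) →
    Counted (Free A S L) (free (length S) (length A) (length L))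
  count-Held : ∀ A x S L → Chain {k} (A ++ S ++ x ∷ L) →
    Counted (Held A x S L) (held (length S) (length A) (length L))
  count-Lower : ∀ A S L → Chain {k} (A ++ S ++ L) →
    Counted (Lower A S L) (lower (length S) (length A) (length L))

  count-Free [] [] [] ch = counted-resp
    [ (λ { refl → end }) , pushLow ]′ (λ { end → inj₁ refl ; (pushLow t) → inj₂ t }) refl
    (counted-∪ counted-[] (count-Lower [] [] [] ch) (λ { refl () }))
  -- A run cannot end while labels remain in L; accordingly, `𝟙` has coefficient 0 here.
  count-Free [] [] (l ∷ L) ch = counted-resp
    pushLow (λ { (pushLow t) → t }) (sym (ℚ.+-identityˡ _))
    (count-Lower [] [] (l ∷ L) ch)
  count-Free (a ∷ A) [] L ch@(_ ∷ ch′) = counted-resp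
    [ (λ { (cons n) → popTop n }) , pushLow ]′
    (λ { (popTop n) → inj₁ (cons n) ; (pushLow t) → inj₂ t }) refl
    (counted-∪ (counted-Cons a (count-Free A [] L ch′)) (count-Lower (a ∷ A) [] L ch)
      (Cons-Lower-disjoint (head∉ ch ∘ ∈-++⁺ʳ A)))
  count-Free (a ∷ A) (s ∷ S) L ch@(_ ∷ ch′) = counted-resp
    [ (λ { (cons n) → popTop n }) , pushLow ]′
    (λ { (popTop n) → inj₁ (cons n) ; (pushLow t) → inj₂ t }) refl
    (counted-∪ (counted-Cons a (count-Free A (s ∷ S) L ch′)) (count-Lower (a ∷ A) (s ∷ S) L ch)
      (Cons-Lower-disjoint (head∉ ch ∘ ∈-++⁺ʳ A ∘ ∈-++⁺ʳ (s ∷ S))))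
  count-Free [] (s ∷ S) L ch@(_ ∷ ch′) = counted-resp
    [ (λ { (cons n) → pushTop n }) , pushLow ]′
    (λ { (pushTop n) → inj₁ (cons n) ; (pushLow t) → inj₂ t }) refl
    (counted-∪ (counted-Cons s (count-Free (s ∷ []) S L ch)) (count-Lower [] (s ∷ S) L ch)
      (Cons-Lower-disjoint (head∉ ch ∘ ∈-++⁺ʳ S)))

  count-Held [] x [] L ch@(_ ∷ ch′) = counted-resp
    [ (λ { (cons n) → popMin n }) , pushLow ]′
    (λ { (popMin n) → inj₁ (cons n) ; (pushLow t) → inj₂ t }) refl
    (counted-∪ (counted-Cons x (count-Free [] [] L ch′)) (count-Lower (x ∷ []) [] L ch)
      (Cons-Lower-disjoint (head∉ ch)))
  count-Held [] x (s ∷ S) L ch@(_ ∷ _) = counted-resp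
    {P = Cons x (Free [] (s ∷ S) L) ∪ Cons s (Cons x (Free (s ∷ []) S L))}
    [ (λ { (cons n) → popMin n }) , (λ { (cons (cons n)) → pushTopPop n }) ]′
    (λ { (popMin n) → inj₁ (cons n) ; (pushTopPop n) → inj₂ (cons (cons n)) }) refl
    (counted-∪ (counted-Cons x (count-Free [] (s ∷ S) L ch′))
      (counted-Cons s (counted-Cons x (count-Free (s ∷ []) S L ch′)))
      (Cons-disjoint (λ { refl → head∉ ch (∈-++⁺ʳ S (here refl)) })))
    where
    ch′ : Chain (s ∷ S ++ L)
    ch′ = Chain-delete (s ∷ S) ch
  count-Held (a ∷ A) x [] L ch@(_ ∷ ch′) = counted-resp
    [ (λ { (cons n) → popTop n }) , pushLow ]′
    (λ { (popTop n) → inj₁ (cons n) ; (pushLow t) → inj₂ t })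
    (cong (λ r → held 0 (length A) (length L) ℚ.+ lower 0 (suc r) (length L)) (length-∷ʳ A))
    (counted-∪ (counted-Cons a (count-Held A x [] L ch′))
      (count-Lower (a ∷ A ++ [ x ]) [] L (subst Chain (sym (++-assoc (a ∷ A) [ x ] L)) ch))
      (Cons-Lower-disjoint (head∉ ch ∘ ∈-++⁺ʳ A ∘ there)))
  -- While A and S are both nonempty, the only move is to pop the head of A.
  count-Held (a ∷ A) x (s ∷ S) L (_ ∷ ch) = counted-resp
    (λ { (cons n) → popTop n }) (λ { (popTop n) → cons n }) refl
    (counted-Cons a (count-Held A x (s ∷ S) L ch))

  -- With L empty there is no new minimum, matching coefficient 0 of a shifted series.
  count-Lower A S [] ch = counted-resp (λ ()) (λ ()) (sym (lower-rec (length S) (length A) 0)) counted-∅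
  count-Lower A S (l ∷ L) ch = counted-resp
    [ (λ { (cons m) → take m }) , skip ]′ (λ { (take m) → inj₁ (cons m) ; (skip t) → inj₂ t })
    (trans
      (cong (λ s → held (length S) (length A) (length L) ℚ.+ lower s (length A) (length L))
        (length-∷ʳ S))
      (sym (lower-rec (length S) (length A) (suc (length L)))))
    (counted-∪ (counted-Cons l (count-Held A l S L ch))
      -- Skipping moves `l` from the head of L to the end of S, which leaves the concatenated chain
      -- unchanged.
      (count-Lower A (S ++ [ l ]) L (subst Chain (sym (++-∷ʳ-assoc A S l L)) ch))
      (Cons-Lower-disjoint (head∉ (Chain-++⁻ʳ S (Chain-++⁻ʳ A ch)))))

-- Runs are the words that respect the queue and avoid 123

module _ {X : Set} where
  private variable
    a s x : X
    U Q v : List X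

  -- v is read off with queue Q and unused labels U, each label of U still to come twice.
  data Fifo : (U Q v : List X) → Set where
    end  : Fifo [] [] []
    pop  : Fifo U Q v → Fifo U (a ∷ Q) (a ∷ v)
    push : ∀ {U₁ U₂} → U ≡ U₁ ++ x ∷ U₂ → Fifo (U₁ ++ U₂) (Q ++ [ x ]) v → Fifo U Q (x ∷ v)

  Fifo⇒queue⊆ : Fifo U Q v → Q ⊆ v
  Fifo⇒queue⊆ end        = []
  Fifo⇒queue⊆ (pop f)    = refl ∷ Fifo⇒queue⊆ f
  Fifo⇒queue⊆ (push _ f) = _ ∷ʳ ⊆-trans (++⁺ʳ _ ⊆-refl) (Fifo⇒queue⊆ f)

  ∈-insert⁻ : ∀ (U₁ : List X) {U₂} → s ∈ U₁ ++ x ∷ U₂ → s ≡ x ⊎ s ∈ U₁ ++ U₂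
  ∈-insert⁻ []       (here eq)  = inj₁ eq
  ∈-insert⁻ []       (there s∈) = inj₂ s∈
  ∈-insert⁻ (_ ∷ U₁) (here eq)  = inj₂ (here eq)
  ∈-insert⁻ (_ ∷ U₁) (there s∈) = [ inj₁ , inj₂ ∘ there ]′ (∈-insert⁻ U₁ s∈)

  Fifo⇒queue∷ʳ⊆ : Fifo U Q v → s ∈ U → Q ++ [ s ] ⊆ v
  Fifo⇒queue∷ʳ⊆ (pop f) s∈U = refl ∷ Fifo⇒queue∷ʳ⊆ f s∈U
  Fifo⇒queue∷ʳ⊆ {Q = Q} (push {x = x} {U₁ = U₁} refl f) s∈U with ∈-insert⁻ U₁ s∈U
  ... | inj₁ refl = _ ∷ʳ Fifo⇒queue⊆ f
  ... | inj₂ s∈   = _ ∷ʳ ⊆-trans (++⁺ (++⁺ʳ [ x ] (⊆-refl {x = Q})) ⊆-refl) (Fifo⇒queue∷ʳ⊆ f s∈)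

  Fifo⇒All : ∀ {P : X → Set} → Fifo U Q v → All P U → All P Q → All P v
  Fifo⇒All end pu pq = []
  Fifo⇒All (pop f) pu (p ∷ pq) = p ∷ Fifo⇒All f pu pq
  Fifo⇒All (push {U₁ = U₁} refl f) pu pq with pu₁ , p ∷ pu₂ ← All.++⁻ U₁ pu =
    p ∷ Fifo⇒All f (All.++⁺ pu₁ pu₂) (All.++⁺ pq (p ∷ []))

  ++-split : ∀ (S : List X) {L U₁ x U₂} → S ++ L ≡ U₁ ++ x ∷ U₂ →
    (∃[ S₂ ] S ≡ U₁ ++ x ∷ S₂ × U₂ ≡ S₂ ++ L) ⊎ (∃[ L₁ ] U₁ ≡ S ++ L₁ × L ≡ L₁ ++ x ∷ U₂)
  ++-split []      {U₁ = U₁}     eq   = inj₂ (U₁ , refl , eq)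
  ++-split (s ∷ S) {U₁ = []}     refl = inj₁ (S , refl , refl)
  ++-split (s ∷ S) {U₁ = u ∷ U₁} eq with refl ← ∷-injectiveˡ eq | ++-split S (∷-injectiveʳ eq)
  ... | inj₁ (S₂ , refl , refl) = inj₁ (S₂ , refl , refl)
  ... | inj₂ (L₁ , refl , refl) = inj₂ (L₁ , refl , refl)

  Lower-push : ∀ {A} S L₁ {L₂ y v} → Held {X} A y (S ++ L₁) L₂ v → Lower A S (L₁ ++ y ∷ L₂) (y ∷ v)
  Lower-push S []       m = take (subst (λ S → Held _ _ S _ _) (++-identityʳ S) m)
  Lower-push S (l ∷ L₁) m =
    skip (Lower-push (S ++ [ l ]) L₁ (subst (λ S → Held _ _ S _ _) (sym (++-assoc S [ l ] L₁)) m))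

module _ {k : ℕ} where
  private variable
    m : ℕ
    a s x y : Fin k
    U Q v : List (Fin k)

  -- v may follow a prefix with minimum m without creating a 123 with at least two letters in v.
  record Avoids (m : ℕ) (v : List (Fin k)) : Set where
    field
      no12>m : ∀ {x y} → m ℕ.< toℕ x → x Fin.< y → ¬ (x ∷ y ∷ [] ⊆ v)
      no123  : ∀ {x y z} → x Fin.< y → y Fin.< z → ¬ (x ∷ y ∷ z ∷ [] ⊆ v)
  open Avoids

  Avoids-tail : Avoids m (x ∷ v) → Avoids m v
  Avoids-tail av = record
    { no12>m = λ p q τ → av .no12>m p q (_ ∷ʳ τ)
    ; no123  = λ p q τ → av .no123 p q (_ ∷ʳ τ)
    }

  Avoids-low⁻ : Avoids m (x ∷ v) → Avoids (toℕ x) v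
  Avoids-low⁻ av = record
    { no12>m = λ p q τ → av .no123 p q (refl ∷ τ)
    ; no123  = Avoids-tail av .no123
    }

  -- A letter above the minimum followed by a larger one would complete a 123 begun by the minimum.
  Avoids-high⁻ : m ℕ.< toℕ x → Avoids m (x ∷ v) → y ∈ v → ¬ x Fin.< y
  Avoids-high⁻ m<x av y∈v x<y = av .no12>m m<x x<y (refl ∷ from∈ y∈v)

  Avoids-low⁺ : toℕ x ℕ.≤ m → Avoids (toℕ x) v → Avoids m (x ∷ v)
  Avoids-low⁺ x≤m av = record
    { no12>m = λ { m<y y<z (refl ∷ τ) → ℕ.<⇒≱ m<y x≤m
                 ; m<y y<z (_ ∷ʳ τ)   → av .no12>m (ℕ.≤-<-trans x≤m m<y) y<z τ }
    ; no123  = λ { x<y y<z (refl ∷ τ) → av .no12>m x<y y<z τ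
                 ; x<y y<z (_ ∷ʳ τ)   → av .no123 x<y y<z τ }
    }

  Avoids-high⁺ : All (Fin._≤ x) v → Avoids m v → Avoids m (x ∷ v)
  Avoids-high⁺ v≤x av = record
    { no12>m = λ { m<y y<z (refl ∷ τ) → ℕ.<⇒≱ y<z (All.lookup v≤x (to∈ τ))
                 ; m<y y<z (_ ∷ʳ τ)   → av .no12>m m<y y<z τ }
    ; no123  = λ { x<y y<z (refl ∷ τ) → ℕ.<⇒≱ x<y (All.lookup v≤x (Any-resp-⊆ τ (here refl)))
                 ; x<y y<z (_ ∷ʳ τ)   → av .no123 x<y y<z τ }
    }

  no-fresh-above-min : ∀ A S L₁ {L₂} → Chain (A ++ S ++ x ∷ L₁ ++ y ∷ L₂) →
    Fifo ((S ++ L₁) ++ L₂) ((A ++ [ x ]) ++ [ y ]) v → Avoids (toℕ y) v → S ≡ []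
  no-fresh-above-min A []      L₁ ch f av = refl
  no-fresh-above-min {y = y} A (s ∷ S) L₁ ch f av =
    contradiction (⊆-trans (++⁺ (++⁺ʳ [ y ] (++⁺ˡ A ⊆-refl)) ⊆-refl) (Fifo⇒queue∷ʳ⊆ f (here refl)))
      (av .no12>m (before ch (++⁺ˡ A (++⁺ˡ (s ∷ S) (refl ∷ from∈ (∈-insert L₁)))))
                  (before ch (++⁺ˡ A (refl ∷ ++⁺ˡ S (refl ∷ minimum _)))))

  -- The bound on `A ++ S` makes every push from `S` a push above the minimum, hence a maximum of
  -- what follows; `complete-pushTop` then leaves only the moves of `Free`.
  complete-Free : ∀ v A S L → Chain (A ++ S ++ L) → All (λ a → m ℕ.< toℕ a) (A ++ S) →
    Fifo (S ++ L) A v → Avoids m v → Free A S L v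
  complete-Held : ∀ v A x S L → Chain (A ++ S ++ x ∷ L) →
    Fifo (S ++ L) (A ++ [ x ]) v → Avoids (toℕ x) v → Held A x S L v
  -- Once `s` has joined behind `x`, the next letter must be `x`. A push of `y` from `S` would be
  -- above the minimum with the larger `s` still to come; a push of `y` from `L` would make `y`,
  -- `x`, `s` a 123.
  complete-pushTopPop : ∀ v x s S L → Chain (s ∷ S ++ x ∷ L) →
    Fifo (S ++ L) (x ∷ s ∷ []) v → Avoids (toℕ x) v → Held [] x (s ∷ S) L (s ∷ v)
  -- The labels of `A` and `U₁` exceed `s` and are still to come, which its being a maximum forbids.
  complete-pushTop : ∀ A U₁ S₂ {ys U₂} → Chain (A ++ (U₁ ++ s ∷ S₂) ++ ys) →
    Fifo (U₁ ++ U₂) (A ++ Q) v → (∀ {y} → y ∈ v → ¬ s Fin.< y) → A ≡ [] × U₁ ≡ []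
  complete-pushLow : ∀ v A S L₁ L₂ → Chain (A ++ S ++ L₁ ++ x ∷ L₂) →
    Fifo ((S ++ L₁) ++ L₂) (A ++ [ x ]) v → Avoids (toℕ x) v → Lower A S (L₁ ++ x ∷ L₂) (x ∷ v)

  complete-Free [] [] [] [] ch high end av = end
  complete-Free (_ ∷ v) (a ∷ A) S L (_ ∷ ch) (_ ∷ high) (pop f) av =
    popTop (complete-Free v A S L ch high f (Avoids-tail av))
  complete-Free (x ∷ v) A S L ch high (push {U₁ = U₁} eq f) av with ++-split S eq
  ... | inj₂ (L₁ , refl , refl) =
    pushLow (complete-pushLow v A S L₁ _ ch f (Avoids-low⁻ av))
  ... | inj₁ (S₂ , refl , refl)
    with refl , refl ← complete-pushTop A U₁ S₂ ch f
           (Avoids-high⁻ (All.lookup high (∈-++⁺ʳ A (∈-insert U₁))) av) =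
    pushTop (complete-Free v [ x ] S₂ L ch high f (Avoids-tail av))

  complete-Held (_ ∷ v) [] x S L ch (pop f) av =
    popMin (complete-Free v [] S L (Chain-delete S ch) (above S ch) f (Avoids-tail av))
  complete-Held (_ ∷ v) (a ∷ A) x S L (_ ∷ ch) (pop f) av =
    popTop (complete-Held v A x S L ch f (Avoids-tail av))
  complete-Held (y ∷ v) A x S L ch (push {U₁ = U₁} eq f) av with ++-split S eq
  ... | inj₁ (S₂ , refl , refl)
    with refl , refl ← complete-pushTop A U₁ S₂ ch (subst (λ Q → Fifo _ Q v) (++-assoc A [ x ] [ y ]) f)
           (Avoids-high⁻ (All.lookup (above S (Chain-++⁻ʳ A ch)) (∈-insert U₁)) av) =
    complete-pushTopPop v x y S₂ L ch f (Avoids-tail av)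
  ... | inj₂ (L₁ , refl , refl)
    with refl ← no-fresh-above-min A S L₁ ch f (Avoids-low⁻ av) =
    pushLow (complete-pushLow v (A ++ [ x ]) [] L₁ _
      (subst Chain (sym (++-assoc A [ x ] L)) ch) f (Avoids-low⁻ av))

  complete-pushTopPop (_ ∷ v) x s S L ch (pop f) av =
    pushTopPop (complete-Free v [ s ] S L (Chain-delete (s ∷ S) ch) (above (s ∷ S) ch) f
      (Avoids-tail av))
  complete-pushTopPop (y ∷ v) x s S L ch (push {U₁ = U₁} eq f) av with ++-split S eq
  ... | inj₁ (S₂ , refl , refl) =
    contradiction (before ch (refl ∷ from∈ (∈-++⁺ˡ (∈-insert U₁))))
      (Avoids-high⁻ (All.lookup (above (s ∷ S) ch) (there (∈-insert U₁))) av
        (Any-resp-⊆ (Fifo⇒queue⊆ f) (there (here refl))))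
  ... | inj₂ (L₁ , refl , refl) =
    contradiction (⊆-trans (refl ∷ refl ∷ minimum _) (Fifo⇒queue⊆ f))
      (Avoids-low⁻ av .no12>m (before ch (++⁺ˡ (s ∷ S) (refl ∷ from∈ (∈-insert L₁))))
                              (before ch (refl ∷ ++⁺ˡ S (refl ∷ minimum _))))

  complete-pushTop [] [] S₂ ch f max = refl , refl
  complete-pushTop [] (u ∷ U₁) S₂ ch f max =
    contradiction (before ch (refl ∷ from∈ (∈-++⁺ˡ (∈-insert U₁))))
      (max (Any-resp-⊆ (Fifo⇒queue∷ʳ⊆ f (here refl)) (∈-++⁺ʳ _ (here refl))))
  complete-pushTop (a ∷ A) U₁ S₂ ch f max =
    contradiction (before ch (refl ∷ from∈ (∈-++⁺ʳ A (∈-++⁺ˡ (∈-insert U₁)))))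
      (max (Any-resp-⊆ (Fifo⇒queue⊆ f) (here refl)))

  complete-pushLow v A S L₁ L₂ ch f av =
    Lower-push S L₁ (complete-Held v A _ (S ++ L₁) L₂
      (subst (λ xs → Chain (A ++ xs)) (sym (++-assoc S L₁ (_ ∷ L₂))) ch) f av)

  sound-Free : ∀ {A S L v} → Free A S L v → Chain (A ++ S ++ L) →
    All (λ l → toℕ l ℕ.≤ m) L → Fifo (S ++ L) A v × Avoids m v
  sound-Lower : ∀ {A S L v} → Lower A S L v → Chain (A ++ S ++ L) →
    All (λ l → toℕ l ℕ.≤ m) L → Fifo (S ++ L) A v × Avoids m v
  sound-Held : ∀ {A x S L v} → Held A x S L v → Chain (A ++ S ++ x ∷ L) →
    Fifo (S ++ L) (A ++ [ x ]) v × Avoids (toℕ x) v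

  sound-Free end ch low = end , record { no12>m = λ _ _ () ; no123 = λ _ _ () }
  sound-Free {A = _ ∷ A} (popTop n) ch@(_ ∷ ch′) low
    with f , av ← sound-Free n ch′ low | A≤ , SL≤ ← All.++⁻ A (below ch) =
    pop f , Avoids-high⁺ (Fifo⇒All f SL≤ A≤) av
  sound-Free (pushTop n) ch low with f , av ← sound-Free n ch low =
    push {U₁ = []} refl f , Avoids-high⁺ (Fifo⇒All f (below ch) (ℕ.≤-refl ∷ [])) av
  sound-Free (pushLow t) ch low = sound-Lower t ch low

  sound-Lower {A = A} {S} {l ∷ L} (take t) ch (l≤m ∷ low) with f , av ← sound-Held t ch =
    push refl f , Avoids-low⁺ l≤m av
  sound-Lower {A = A} {S} {l ∷ L} (skip t) ch (l≤m ∷ low)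
    with f , av ← sound-Lower t (subst Chain (sym (++-∷ʳ-assoc A S l L)) ch) low =
    subst (λ U → Fifo U _ _) (++-assoc S [ l ] L) f , av

  sound-Held {A = _ ∷ A} {x} {S} (popTop t) ch@(_ ∷ ch′)
    with f , av ← sound-Held t ch′ | A≤ , SxL≤ ← All.++⁻ A (below ch)
    with S≤ , x≤ ∷ L≤ ← All.++⁻ S SxL≤ =
    pop f , Avoids-high⁺ (Fifo⇒All f (All.++⁺ S≤ L≤) (All.++⁺ A≤ (x≤ ∷ []))) av
  sound-Held {x = x} {S} (popMin n) ch
    with f , av ← sound-Free n (Chain-delete S ch) (below (Chain-++⁻ʳ S ch)) =
    pop f , Avoids-low⁺ ℕ.≤-refl av
  sound-Held {x = x} {s ∷ S} (pushTopPop n) ch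
    with f , av ← sound-Free n (Chain-delete (s ∷ S) ch) (below (Chain-++⁻ʳ (s ∷ S) ch)) =
    push {U₁ = []} refl (pop f) ,
    Avoids-high⁺
      (All.head (All.++⁻ʳ S (below ch)) ∷
       Fifo⇒All f (below (Chain-delete (s ∷ S) ch)) (ℕ.≤-refl ∷ []))
      (Avoids-low⁺ ℕ.≤-refl av)
  sound-Held {A = A} {x} {_} {L} (pushLow t) ch =
    sound-Lower t (subst Chain (sym (++-assoc A [ x ] L)) ch) (below (Chain-++⁻ʳ A ch))

-- Nonnesting words are the words that respect the queue

module _ {X : Set} where

  -- Together with its converse this translates patterns at increasing positions into sublists;
  -- dropping `suc (toℕ i)` letters encodes that the next position is strictly larger.
  ⊆-drop⁺ : ∀ {n} (w : Vec X n) i {k xs} → k ℕ.≤ toℕ i →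
    xs ⊆ drop (suc (toℕ i)) (toList w) → lookup w i ∷ xs ⊆ drop k (toList w)
  ⊆-drop⁺ (x ∷ w) zero    {zero}  k≤i τ = refl ∷ τ
  ⊆-drop⁺ (x ∷ w) (suc i) {zero}  k≤i τ = x ∷ʳ ⊆-drop⁺ w i z≤n τ
  ⊆-drop⁺ (x ∷ w) (suc i) {suc k} k≤i τ = ⊆-drop⁺ w i (ℕ.s≤s⁻¹ k≤i) τ

  ⊆-drop⁻ : ∀ {n} (w : Vec X n) k {x xs} → x ∷ xs ⊆ drop k (toList w) →
    ∃[ i ] k ℕ.≤ toℕ i × lookup w i ≡ x × xs ⊆ drop (suc (toℕ i)) (toList w)
  ⊆-drop⁻ (_ ∷ w) zero    (refl ∷ τ) = zero , z≤n , refl , τ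
  ⊆-drop⁻ (_ ∷ w) zero    (_ ∷ʳ τ) with i , _ , eq , σ ← ⊆-drop⁻ w zero τ = suc i , z≤n , eq , σ
  ⊆-drop⁻ (_ ∷ w) (suc k) τ with i , k≤i , eq , σ ← ⊆-drop⁻ w k τ = suc i , s≤s k≤i , eq , σ
  ⊆-drop⁻ []      zero    ()
  ⊆-drop⁻ []      (suc k) ()

  ⊆-remove : ∀ {a : X} {xs} ys {zs} → ¬ a ∈ xs → xs ⊆ ys ++ a ∷ zs → xs ⊆ ys ++ zs
  ⊆-remove []       a∉ (_ ∷ʳ τ)   = τ
  ⊆-remove []       a∉ (refl ∷ τ) = contradiction (here refl) a∉
  ⊆-remove (y ∷ ys) a∉ (_ ∷ʳ τ)   = y ∷ʳ ⊆-remove ys a∉ τ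
  ⊆-remove (y ∷ ys) a∉ (refl ∷ τ) = refl ∷ ⊆-remove ys (a∉ ∘ there) τ

  -- The final `a` cannot be matched beyond the displayed one, so what precedes it fits into `ys`.
  ⊆-before-last : ∀ {a : X} xs ys {zs} → ¬ a ∈ zs → xs ++ [ a ] ⊆ ys ++ a ∷ zs → xs ⊆ ys
  ⊆-before-last []       ys       a∉ τ          = minimum ys
  ⊆-before-last (x ∷ xs) []       a∉ (_ ∷ʳ τ)   =
    contradiction (Any-resp-⊆ τ (there (∈-++⁺ʳ xs (here refl)))) a∉
  ⊆-before-last (x ∷ xs) []       a∉ (_ ∷ τ)    =
    contradiction (Any-resp-⊆ τ (∈-++⁺ʳ xs (here refl))) a∉
  ⊆-before-last (x ∷ xs) (y ∷ ys) a∉ (_ ∷ʳ τ)   = y ∷ʳ ⊆-before-last (x ∷ xs) ys a∉ τ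
  ⊆-before-last (x ∷ xs) (y ∷ ys) a∉ (refl ∷ τ) = refl ∷ ⊆-before-last xs ys a∉ τ

  Fifo-length : ∀ {U Q v : List X} → Fifo U Q v → length v ≡ length Q ℕ.+ 2 ℕ.* length U
  Fifo-length end = refl
  Fifo-length (pop f) = cong suc (Fifo-length f)
  Fifo-length {Q = Q} (push {x = x} {U₁ = U₁} {U₂} refl f) = trans (cong suc (Fifo-length f)) (trans
    (cong₂ (λ m n → suc (m ℕ.+ 2 ℕ.* n)) (length-∷ʳ Q) (length-++ U₁))
    (trans (solve 3 (λ q m n →
          con 1 :+ ((con 1 :+ q) :+ con 2 :* (m :+ n)) := q :+ con 2 :* (m :+ (con 1 :+ n))) refl
        (length Q) (length U₁) (length U₂))
      (cong (λ n → length Q ℕ.+ 2 ℕ.* n) (sym (length-++ U₁)))))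
    where open ℕ.+-*-Solver using (solve; con; _:=_; _:+_; _:*_)

-- Occurrence numbers of labels

module _ {k : ℕ} where

  δ : Fin k → Fin k → ℕ
  δ a x = if does (a Fin.≟ x) then 1 else 0

  occ : Fin k → List (Fin k) → ℕ
  occ a []       = 0
  occ a (x ∷ xs) = δ a x ℕ.+ occ a xs

  count≡occ : ∀ a {n} (w : Vec (Fin k) n) → Vec.count (a Fin.≟_) w ≡ occ a (toList w)
  count≡occ a []      = refl
  count≡occ a (x ∷ w) with does (a Fin.≟ x)
  ... | true  = cong suc (count≡occ a w)
  ... | false = count≡occ a w

  δ-refl : ∀ a → δ a a ≡ 1
  δ-refl a with a Fin.≟ a
  ... | yes _  = refl
  ... | no a≢a = contradiction refl a≢a

  occ-++ : ∀ a xs ys → occ a (xs ++ ys) ≡ occ a xs ℕ.+ occ a ys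
  occ-++ a []       ys = refl
  occ-++ a (x ∷ xs) ys =
    trans (cong (δ a x ℕ.+_) (occ-++ a xs ys)) (sym (ℕ.+-assoc (δ a x) (occ a xs) (occ a ys)))

  occ-mono : ∀ a {xs ys} → xs ⊆ ys → occ a xs ℕ.≤ occ a ys
  occ-mono a []         = z≤n
  occ-mono a (y ∷ʳ τ)   = ℕ.≤-trans (occ-mono a τ) (ℕ.m≤n+m _ (δ a y))
  occ-mono a (refl ∷ τ) = ℕ.+-monoʳ-≤ (δ a _) (occ-mono a τ)

  ∈⇒occ>0 : ∀ {a xs} → a ∈ xs → 0 ℕ.< occ a xs
  ∈⇒occ>0 {a} a∈xs =
    ℕ.≤-trans (ℕ.≤-reflexive (sym (trans (ℕ.+-identityʳ (δ a a)) (δ-refl a)))) (occ-mono a (from∈ a∈xs))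

  occ>0⇒∈ : ∀ {a} xs → 0 ℕ.< occ a xs → a ∈ xs
  occ>0⇒∈ {a} (x ∷ xs) 0< with a Fin.≟ x
  ... | yes refl = here refl
  ... | no  _    = there (occ>0⇒∈ xs 0<)

  occ-pair : ∀ a {xs} → a ∷ a ∷ [] ⊆ xs → 2 ℕ.≤ occ a xs
  occ-pair a {xs} τ =
    subst (ℕ._≤ occ a xs) (cong₂ (λ m n → m ℕ.+ (n ℕ.+ 0)) (δ-refl a) (δ-refl a)) (occ-mono a τ)

  Nonnest : List (Fin k) → Set
  Nonnest v = ∀ {a b} → a ≢ b → ¬ (a ∷ b ∷ b ∷ a ∷ [] ⊆ v)

  Balanced : (U Q v : List (Fin k)) → Set
  Balanced U Q v = ∀ a → occ a v ≡ occ a Q ℕ.+ (occ a U ℕ.+ occ a U)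

  Distinct : (U Q : List (Fin k)) → Set
  Distinct U Q = ∀ a → occ a Q ℕ.+ occ a U ℕ.≤ 1

  private variable
    U Q v : List (Fin k)

  open ℕ.+-*-Solver using (solve; con; _:=_; _:+_; _:*_)

  occ-insert : ∀ a x U₁ U₂ → occ a (U₁ ++ x ∷ U₂) ≡ δ a x ℕ.+ occ a (U₁ ++ U₂)
  occ-insert a x U₁ U₂ = trans (occ-++ a U₁ (x ∷ U₂)) (trans
    (solve 3 (λ u d w → u :+ (d :+ w) := d :+ (u :+ w)) refl (occ a U₁) (δ a x) (occ a U₂))
    (cong (δ a x ℕ.+_) (sym (occ-++ a U₁ U₂))))

  occ-snoc : ∀ a x Q → occ a (Q ++ [ x ]) ≡ δ a x ℕ.+ occ a Q
  occ-snoc a x Q = trans (occ-++ a Q [ x ])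
    (trans (cong (occ a Q ℕ.+_) (ℕ.+-identityʳ (δ a x))) (ℕ.+-comm (occ a Q) (δ a x)))

  Balanced-push : ∀ a x Q U₁ U₂ →
    δ a x ℕ.+ (occ a (Q ++ [ x ]) ℕ.+ (occ a (U₁ ++ U₂) ℕ.+ occ a (U₁ ++ U₂))) ≡
    occ a Q ℕ.+ (occ a (U₁ ++ x ∷ U₂) ℕ.+ occ a (U₁ ++ x ∷ U₂))
  Balanced-push a x Q U₁ U₂ rewrite occ-insert a x U₁ U₂ | occ-snoc a x Q =
    solve 3 (λ d q u → d :+ ((d :+ q) :+ (u :+ u)) := q :+ ((d :+ u) :+ (d :+ u))) refl
      (δ a x) (occ a Q) (occ a (U₁ ++ U₂))

  Distinct-push : ∀ x Q U₁ U₂ → Distinct (U₁ ++ x ∷ U₂) Q → Distinct (U₁ ++ U₂) (Q ++ [ x ])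
  Distinct-push x Q U₁ U₂ distinct a = subst (ℕ._≤ 1)
    (trans (cong (occ a Q ℕ.+_) (occ-insert a x U₁ U₂)) (trans
      (solve 3 (λ q d u → q :+ (d :+ u) := (d :+ q) :+ u) refl (occ a Q) (δ a x) (occ a (U₁ ++ U₂)))
      (cong (ℕ._+ occ a (U₁ ++ U₂)) (sym (occ-snoc a x Q)))))
    (distinct a)

  Distinct-pop : ∀ x U Q → Distinct U (x ∷ Q) → Distinct U Q
  Distinct-pop x U Q distinct a =
    ℕ.≤-trans (ℕ.+-monoˡ-≤ (occ a U) (ℕ.m≤n+m (occ a Q) (δ a x))) (distinct a)

  Balanced-head : ∀ {x} → Balanced U Q (x ∷ v) → x ∈ Q ⊎ x ∈ U
  Balanced-head {U} {Q} {v} {x} bal = map₂ ([ id , id ]′ ∘ ∈-++⁻ U) (∈-++⁻ Q (occ>0⇒∈ (Q ++ U ++ U)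
    (subst (0 ℕ.<_)
      (trans (bal x) (sym (trans (occ-++ x Q (U ++ U)) (cong (occ x Q ℕ.+_) (occ-++ x U U)))))
      (∈⇒occ>0 {x} {x ∷ v} (here refl)))))

  -- In `Q ++ v` the queue stands for the first copies of the labels seen once. If the letter `x`
  -- were queued behind another label `q`, then `q` and `x` in the queue, the letter `x` and the
  -- later copy of `q` would form a nesting.
  toFifo : ∀ v {U Q} → Balanced U Q v → Distinct U Q → Nonnest (Q ++ v) → Fifo U Q v
  toFifo [] {[]} {[]} bal distinct nonnest = end
  toFifo [] {_} {q ∷ Q} bal distinct nonnest =
    contradiction (bal q) (ℕ.<⇒≢ (ℕ.≤-trans (∈⇒occ>0 {q} {q ∷ Q} (here refl)) (ℕ.m≤m+n _ _)))
  toFifo [] {u ∷ U} {[]} bal distinct nonnest =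
    contradiction (bal u) (ℕ.<⇒≢ (ℕ.≤-trans (∈⇒occ>0 {u} {u ∷ U} (here refl)) (ℕ.m≤m+n _ _)))
  toFifo (x ∷ v) {U} {Q} bal distinct nonnest with Balanced-head {U} {Q} {v} bal
  ... | inj₁ x∈Q with ∈-∃++ x∈Q
  ...   | [] , Q₂ , refl = pop (toFifo v
          (λ a → ℕ.+-cancelˡ-≡ (δ a x) _ _ (trans (bal a) (ℕ.+-assoc (δ a x) (occ a Q₂) _)))
          (Distinct-pop x U Q₂ distinct)
          (λ a≢b τ → nonnest a≢b (x ∷ʳ ⊆-trans τ (++⁺ (⊆-refl {x = Q₂}) (x ∷ʳ ⊆-refl)))))
  ...   | q ∷ Q₁ , Q₂ , refl =
          contradiction
            (refl ∷ subst (_ ⊆_) (sym (++-assoc Q₁ (x ∷ Q₂) (x ∷ v)))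
              (++⁺ˡ Q₁ (refl ∷ ++⁺ˡ Q₂ (refl ∷ from∈ q∈v))))
            (nonnest q≢x)
          where
          q≢x : q ≢ x
          q≢x refl = ℕ.<⇒≱ (occ-pair q (refl ∷ ++⁺ˡ Q₁ (refl ∷ minimum Q₂)))
            (ℕ.≤-trans (ℕ.m≤m+n _ _) (distinct q))
          q∈v : q ∈ v
          q∈v with occ>0⇒∈ (x ∷ v) (subst (0 ℕ.<_) (sym (bal q))
                     (ℕ.≤-trans (∈⇒occ>0 {q} {q ∷ Q₁ ++ x ∷ Q₂} (here refl)) (ℕ.m≤m+n _ _)))
          ... | here q≡x  = contradiction q≡x q≢x
          ... | there q∈v = q∈v
  toFifo (x ∷ v) {U} {Q} bal distinct nonnest | inj₂ x∈U
    with U₁ , U₂ , refl ← ∈-∃++ x∈U = push refl (toFifo v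
          (λ a → ℕ.+-cancelˡ-≡ (δ a x) _ _ (trans (bal a) (sym (Balanced-push a x Q U₁ U₂))))
          (Distinct-push x Q U₁ U₂ distinct)
          -- A push only moves the border between queue and remaining word; the concatenation stays
          -- the same.
          (subst Nonnest (sym (++-assoc Q [ x ] v)) nonnest))

  Fifo⇒Balanced : Fifo U Q v → Balanced U Q v
  Fifo⇒Balanced end a = refl
  Fifo⇒Balanced {U} (pop {Q = Q} {a = x} f) a =
    trans (cong (δ a x ℕ.+_) (Fifo⇒Balanced f a)) (sym (ℕ.+-assoc (δ a x) (occ a Q) _))
  Fifo⇒Balanced {Q = Q} (push {x = x} {U₁ = U₁} {U₂} refl f) a =
    trans (cong (δ a x ℕ.+_) (Fifo⇒Balanced f a)) (Balanced-push a x Q U₁ U₂)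

  -- When `x` is popped, its only copies in `x ∷ Q ++ x ∷ v` are the displayed ones. As outer label
  -- they would enclose two equal labels of `Q`, which are distinct; as inner label they would need
  -- a letter before the first; and a nesting without `x` survives the removal of both.
  Fifo⇒Nonnest : Fifo U Q v → Distinct U Q → Nonnest (Q ++ v)
  Fifo⇒Nonnest end distinct a≢b ()
  Fifo⇒Nonnest {v = x ∷ v} (push {Q = Q} {U₁ = U₁} {U₂} refl f) distinct =
    subst Nonnest (++-assoc Q [ x ] v) (Fifo⇒Nonnest f (Distinct-push x Q U₁ U₂ distinct))
  Fifo⇒Nonnest {U} (pop {Q = Q} {v} {x} f) distinct {a} {b} a≢b τ = nested (x Fin.≟ a) (x Fin.≟ b) τ
    where
    occ-QU≡0 : occ x Q ℕ.+ occ x U ≡ 0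
    occ-QU≡0 = ℕ.n≤0⇒n≡0 (ℕ.s≤s⁻¹
      (subst (λ d → (d ℕ.+ occ x Q) ℕ.+ occ x U ℕ.≤ 1) (δ-refl x) (distinct x)))
    occ-Q≡0 : occ x Q ≡ 0
    occ-Q≡0 = ℕ.m+n≡0⇒m≡0 (occ x Q) occ-QU≡0
    occ-U≡0 : occ x U ≡ 0
    occ-U≡0 = ℕ.m+n≡0⇒n≡0 (occ x Q) occ-QU≡0
    occ-v≡0 : occ x v ≡ 0
    occ-v≡0 = trans (Fifo⇒Balanced f x) (cong₂ (λ m n → m ℕ.+ (n ℕ.+ n)) occ-Q≡0 occ-U≡0)
    x∉v : ¬ x ∈ v
    x∉v x∈v = ℕ.<⇒≢ (∈⇒occ>0 x∈v) (sym occ-v≡0)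
    occ-tail≡1 : occ x (Q ++ x ∷ v) ≡ 1
    occ-tail≡1 = trans (occ-++ x Q (x ∷ v)) (cong₂ ℕ._+_ occ-Q≡0 (cong₂ ℕ._+_ (δ-refl x) occ-v≡0))
    nested : Dec (x ≡ a) → Dec (x ≡ b) → ¬ (a ∷ b ∷ b ∷ a ∷ [] ⊆ x ∷ Q ++ x ∷ v)
    nested (yes refl) _ τ =
      ℕ.<⇒≱ (occ-pair b (⊆-before-last (b ∷ b ∷ []) Q x∉v (∷⁻ τ)))
        (ℕ.≤-trans (ℕ.m≤n+m (occ b Q) (δ b x)) (ℕ.≤-trans (ℕ.m≤m+n _ (occ b U)) (distinct b)))
    nested (no x≢a) (yes refl) (refl ∷ τ) = x≢a refl
    nested (no x≢a) (yes refl) (_ ∷ʳ τ) =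
      ℕ.<⇒≱ (occ-pair x (⊆-trans (_ ∷ʳ refl ∷ refl ∷ minimum _) τ)) (ℕ.≤-reflexive occ-tail≡1)
    nested (no x≢a) (no x≢b) (refl ∷ τ) = x≢a refl
    nested (no x≢a) (no x≢b) (_ ∷ʳ τ) = Fifo⇒Nonnest f (Distinct-pop x U Q distinct) a≢b
      (⊆-remove Q (λ { (here eq) → x≢a eq ; (there (here eq)) → x≢b eq
                     ; (there (there (here eq))) → x≢b eq
                     ; (there (there (there (here eq)))) → x≢a eq }) τ)

-- The initial state and the number of words

labels : ∀ n → List (Fin n)
labels n = tabulate opposite

labels-Chain : ∀ n → Chain (labels n)
labels-Chain n = tabulate⁺-< (λ {i} {j} i<j →
  subst₂ ℕ._<_ (sym (Fin.opposite-prop j)) (sym (Fin.opposite-prop i))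
  (ℕ.∸-monoʳ-< (s≤s i<j) (Fin.toℕ<n j)))

Chain⇒occ≤1 : ∀ {k} {xs : List (Fin k)} → Chain xs → ∀ a → occ a xs ℕ.≤ 1
Chain⇒occ≤1 [] a = z≤n
Chain⇒occ≤1 {xs = x ∷ xs} (x> ∷ ch) a with a Fin.≟ x
... | no _     = Chain⇒occ≤1 ch a
... | yes refl = s≤s (ℕ.≮⇒≥ (λ 0<occ → Fin.<-irrefl refl (All.lookup x> (occ>0⇒∈ xs 0<occ))))

labels-occ : ∀ {n} (a : Fin n) → occ a (labels n) ≡ 1
labels-occ {n} a = ℕ.≤-antisym (Chain⇒occ≤1 (labels-Chain n) a)
  (∈⇒occ>0 (subst (_∈ labels n) (Fin.opposite-involutive a) (∈-tabulate⁺ (opposite a))))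

module _ {n : ℕ} (w : Word n) where

  Nonnest⁺ : ¬ HasNesting w → Nonnest (toList w)
  Nonnest⁺ ¬nest {a} {b} a≢b τ
    with i , _ , eqi , τ ← ⊆-drop⁻ w 0 τ
    with j , i<j , eqj , τ ← ⊆-drop⁻ w _ τ
    with k , j<k , eqk , τ ← ⊆-drop⁻ w _ τ
    with ℓ , k<ℓ , eqℓ , τ ← ⊆-drop⁻ w _ τ =
    ¬nest (i , j , k , ℓ , a , b , i<j , j<k , k<ℓ , a≢b , eqi , eqℓ , eqj , eqk)

  Nonnest⁻ : Nonnest (toList w) → ¬ HasNesting w
  Nonnest⁻ nonnest (i , j , k , ℓ , a , b , i<j , j<k , k<ℓ , a≢b , refl , eqℓ , refl , eqk) =
    nonnest a≢b (⊆-drop⁺ w i z≤n (⊆-drop⁺ w j i<j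
      (subst (λ c → c ∷ _ ∷ [] ⊆ _) eqk (⊆-drop⁺ w k j<k
        (subst (λ c → c ∷ [] ⊆ _) eqℓ (⊆-drop⁺ w ℓ k<ℓ (minimum _)))))))

  Avoids⁺ : Avoids123 w → Avoids n (toList w)
  Avoids⁺ avoids = record
    -- The initial bound `n` exceeds every label, so no letter lies above it.
    { no12>m = λ {x} n<x → contradiction (Fin.toℕ<n x) (ℕ.<-asym n<x)
    ; no123  = no123
    }
    where
    no123 : ∀ {x y z} → x Fin.< y → y Fin.< z → ¬ (x ∷ y ∷ z ∷ [] ⊆ toList w)
    no123 x<y y<z τ
      with i , _ , refl , τ ← ⊆-drop⁻ w 0 τ
      with j , i<j , refl , τ ← ⊆-drop⁻ w _ τ
      with k , j<k , refl , τ ← ⊆-drop⁻ w _ τ =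
      avoids (i , j , k , i<j , j<k , x<y , y<z)

  Avoids⁻ : Avoids n (toList w) → Avoids123 w
  Avoids⁻ av (i , j , k , i<j , j<k , x<y , y<z) =
    Avoids.no123 av x<y y<z (⊆-drop⁺ w i z≤n (⊆-drop⁺ w j i<j (⊆-drop⁺ w k j<k (minimum _))))

  labels-Balanced⁺ : UsesEachLabelTwice w → Balanced (labels n) [] (toList w)
  labels-Balanced⁺ twice a rewrite labels-occ a = trans (sym (count≡occ a w)) (twice a)

  labels-Balanced⁻ : Balanced (labels n) [] (toList w) → UsesEachLabelTwice w
  labels-Balanced⁻ bal a =
    trans (count≡occ a w) (trans (bal a) (cong₂ ℕ._+_ (labels-occ a) (labels-occ a)))

labels-Distinct : ∀ n → Distinct (labels n) []
labels-Distinct n a = ℕ.≤-reflexive (labels-occ a)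

-- Before the first letter every label counts as lying below the minimum, so L holds all labels
-- while A and S are empty.
Run⁺ : ∀ {n} (w : Word n) → Nonnesting w × Avoids123 w → Free [] [] (labels n) (toList w)
Run⁺ w ((twice , ¬nest) , avoids) = complete-Free (toList w) [] [] (labels _) (labels-Chain _) []
  (toFifo (toList w) (labels-Balanced⁺ w twice) (labels-Distinct _) (Nonnest⁺ w ¬nest))
  (Avoids⁺ w avoids)

Run⇒Fifo : ∀ {n v} → Free [] [] (labels n) v → Fifo (labels n) [] v × Avoids n v
Run⇒Fifo {n} run = sound-Free run (labels-Chain n) (All.tabulate λ {l} _ → ℕ.<⇒≤ (Fin.toℕ<n l))

Run⁻ : ∀ {n} (w : Word n) → Free [] [] (labels n) (toList w) → Nonnesting w × Avoids123 w
Run⁻ w run with f , av ← Run⇒Fifo run =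
  (labels-Balanced⁻ w (Fifo⇒Balanced f) , Nonnest⁻ w (Fifo⇒Nonnest f (labels-Distinct _))) , Avoids⁻ w av

Run⇒Word : ∀ {n v} → Free [] [] (labels n) v → ∃[ w ] v ≡ toList {n = 2 ℕ.* n} w
Run⇒Word {n} {v} run = fromList-≡ v
  (trans (Fifo-length (proj₁ (Run⇒Fifo run))) (cong (2 ℕ.*_) (length-tabulate (opposite {n}))))
  where
  fromList-≡ : ∀ {m} (v : List (Fin n)) → length v ≡ m → ∃[ w ] v ≡ toList {n = m} w
  fromList-≡ v refl = Vec.fromList v , sym (toList∘fromList v)

-- Two lists without repetition and with the same members are permutations of each other.
c≡length-words : ∀ {n q} (counted : Counted (Free [] [] (labels n)) q) →
  c n ≡ length (Counted.words counted)
c≡length-words {n} counted = trans (sym (length-map toList ws))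
  (↭-length (∼bag⇒↭ (unique∧set⇒bag
    (Unique.map⁺ toList-inj (Unique.filter⁺ P? (allVecs-unique n (2 ℕ.* n)))) unique
    (mk⇔ to from))))
  where
  open Counted counted
  P? : Decidable (λ w → Nonnesting {n} w × Avoids123 w)
  P? w = nonnesting? w ×-dec avoids123? w
  ws : List (Word n)
  ws = filter P? (allVecs n (2 ℕ.* n))
  toList-inj : ∀ {xs ys : Word n} → toList xs ≡ toList ys → xs ≡ ys
  toList-inj {xs} {ys} eq = trans (sym (cast-is-id refl xs)) (toList-injective refl xs ys eq)
  to : ∀ {v} → v ∈ map toList ws → v ∈ words
  to v∈ with w , w∈ , refl ← ∈-map⁻ toList v∈ =
    complete (Run⁺ w (proj₂ (∈-filter⁻ P? {xs = allVecs n (2 ℕ.* n)} w∈)))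
  from : ∀ {v} → v ∈ words → v ∈ map toList ws
  from v∈ with w , refl ← Run⇒Word (sound v∈) =
    ∈-map⁺ toList (∈-filter⁺ P? (∈-allVecs w) (Run⁻ w (sound v∈)))

theorem1p1 : (V U : ℚ[[z]]) →
    V 0 ≡ 1ℚ → V ≗ 𝟙 + z· (V * V) →
    U 0 ≡ 1ℚ → U ≗ 𝟙 + z· 𝟛 + z· (U * U) →
    C ≗ 𝟙 + (z· (𝟙 + U)) / (𝟚 - z· ((𝟙 + U) * (𝟙 + V)))
theorem1p1 V U _ V-eq _ U-eq n =
  trans (cong (λ m → + m ℚ./ 1) (c≡length-words counted)) (trans (Counted.size counted)
  (trans (cong (free 0 0) (length-tabulate (opposite {n}))) (free-00 n)))
  where
  counted = Counting.count-Free V U V-eq U-eq [] [] (labels n) (labels-Chain n)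
  open States V U V-eq U-eq
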